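{- (i) $\mathrm{ex}_<(n,P_5^{1342})=\Omega(n\log n)$, and (ii) $\mathrm{ex}_<(n,P_5^{2143})=\Theta(n\log n)$.
   Context: Edge-ordered graph: finite simple graph with a linear order on its edges; isomorphisms preserve order; subgraphs carry induced order; $\mathrm{ex}_<(n,H)$ is the maximum number of edges of an edge-ordered graph on $n$ vertices with no subgraph isomorphic to $H$. Notation: $P_k^{a_1\dots a_{k-1}}$ is the path $v_1\dots v_k$ where edge $v_iv_{i+1}$ has label $a_i$ and edges are ordered by label. -}

module Defs where

open import Data.Nat using (ℕ; _<_; _≤_; _*_)
open import Data.Fin using (Fin; zero; suc; inject₁; toℕ)
import Data.Fin as F
open import Data.Product using (Σ; proj₁; proj₂; _×_; _,_; ∃; ∃-syntax)
open import Data.Sum using (_⊎_)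
open import Data.List using (List; length; lookup)
open import Data.List.Relation.Unary.All using (All)
open import Data.List.Relation.Unary.Unique.Propositional using (Unique)
open import Data.Vec using (Vec; _∷_; [])
import Data.Vec as V
open import Function.Definitions using (Injective)
open import Relation.Binary.PropositionalEquality using (_≡_)

-- An edge-ordered (finite simple) graph on vertex set Fin n.
-- Edges are stored as pairs (u , v) with u < v (so each unordered pair of
-- distinct vertices has one canonical representation, no loops), without
-- repetitions; the linear order on the edges is their position in the list.
record EOGraph (n : ℕ) : Set where
  field
    edges  : List (Fin n × Fin n)
    simple : All (λ e → proj₁ e F.< proj₂ e) edges
    unique : Unique edges

open EOGraph public

∣E∣ : ∀ {n} → EOGraph n → ℕ
∣E∣ G = length (edges G)

EdgeAt : ∀ {n} (G : EOGraph n) → Fin (length (edges G)) → Fin n → Fin n → Set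
EdgeAt G i u v = (lookup (edges G) i ≡ (u , v)) ⊎ (lookup (edges G) i ≡ (v , u))

-- G contains a subgraph isomorphic (as an edge-ordered graph) to the path
-- P_5^{a₁a₂a₃a₄}, where edge v_i v_{i+1} has label a i (labels distinct):
-- an injective map f of the path's vertices into G, mapping the path edge i
-- to the edge of G at position pos i, such that the order is preserved.
ContainsP5 : ∀ {n} → EOGraph n → (Fin 4 → ℕ) → Set
ContainsP5 {n} G a =
  Σ (Fin 5 → Fin n) λ f → Injective _≡_ _≡_ f ×
  Σ (Fin 4 → Fin (length (edges G))) λ pos →
    ((∀ (i : Fin 4) → EdgeAt G (pos i) (f (inject₁ i)) (f (suc i))) ×
     (∀ (i j : Fin 4) → a i < a j → pos i F.< pos j))

P5-1342 : Fin 4 → ℕ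
P5-1342 = V.lookup (1 ∷ 3 ∷ 4 ∷ 2 ∷ [])

P5-2143 : Fin 4 → ℕ
P5-2143 = V.lookup (2 ∷ 1 ∷ 4 ∷ 3 ∷ [])

{-# OPTIONS --safe #-}

-- Lower bounds: join two copies A and B of a graph by a perfect matching M.
-- Ordering the edges as A < B < M creates no new P_5^{1342}, and A < M < B no
-- new P_5^{2143}, while e(2m) = 2e(m) + m.
--
-- Upper bound for P_5^{2143}: cut the edge order into halves L < U, and at
-- every vertex delete its last three L-edges and its first three U-edges. If a
-- vertex c kept an L-edge ca and a U-edge cb, then ca could be extended at a by
-- a later L-edge and cb at b by an earlier U-edge (three candidates suffice to
-- keep the vertices distinct), giving P_5^{2143}. So the remaining parts of L and U
-- live on disjoint vertex sets; one of these has at most half the vertices,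
-- and e(s) ≤ 2 (3s + e(s/2)) + 1.
module Submission where

open import Defs
open import Data.Nat using (ℕ; zero; suc; _≤_; _<_; _+_; _*_; _∸_; _^_; z≤n; s≤s; s<s; z<s; s<s⁻¹; ⌊_/2⌋; ⌈_/2⌉)
open import Data.Nat.Logarithm using (⌊log₂_⌋; ⌊log₂⌋-mono-≤; ⌊log₂[2^n]⌋≡n; ⌊log₂⌊n/2⌋⌋≡⌊log₂n⌋∸1)
open import Data.Nat.Properties
open import Data.Nat.Induction using (<-rec)
open import Data.Nat.Tactic.RingSolver using (solve-∀)
open import Data.Fin using (Fin; zero; suc; inject₁; toℕ; combine; remQuot; _↑ˡ_; splitAt)
import Data.Fin as F
import Data.Fin.Properties as F
open import Data.Fin.Patterns using (0F; 1F; 2F; 3F)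
open import Data.Product using (Σ; _×_; _,_; proj₁; proj₂; ∃; ∃₂)
import Data.Product as Prod
import Data.Product.Properties as Prod
open import Data.Sum using (_⊎_; inj₁; inj₂; [_,_]′)
import Data.Sum as Sum
open import Data.Empty using (⊥)
open import Data.List using (List; []; _∷_; _++_; [_]; length; lookup; map; take; drop; reverse; filter; allFin)
open import Data.List.Properties using (length-++; length-map; length-tabulate; length-reverse; length-take; length-drop; take++drop≡id; map-∘; map-id; map-cong; reverse-involutive)
open import Data.List.Membership.Propositional using (_∈_; lose; find)
open import Data.List.Membership.Propositional.Properties using (∈-map⁻; ∈-++⁻; ∈-++⁺ˡ; ∈-++⁺ʳ; ∈-filter⁺; ∈-allFin)
open import Data.List.Relation.Unary.Any using (Any; here; there; any?)
import Data.List.Relation.Unary.Any.Properties as Any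
open import Data.List.Relation.Unary.All using (All; []; _∷_)
import Data.List.Relation.Unary.All as All
import Data.List.Relation.Unary.All.Properties as All
open import Data.List.Relation.Unary.AllPairs using (AllPairs; []; _∷_)
open import Data.List.Relation.Unary.Linked using (Linked; []; [-]; _∷_)
import Data.List.Relation.Unary.Linked as Linked
import Data.List.Relation.Unary.Linked.Properties as Linked
open import Data.List.Relation.Unary.Unique.Propositional using (Unique)
import Data.List.Relation.Unary.Unique.Propositional.Properties as Unique
open import Data.List.Relation.Binary.Disjoint.Propositional using (Disjoint)
open import Data.List.Relation.Binary.Sublist.Propositional using (_⊆_; []; _∷_; _∷ʳ_; ⊆-refl; ⊆-trans; ⊆-reflexive; minimum; from∈; to∈)
import Data.List.Relation.Binary.Sublist.Propositional as Sublist
import Data.List.Relation.Binary.Sublist.Propositional.Properties as Sublist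
open import Data.Vec using ([]; _∷_)
import Data.Vec as Vec
open import Data.Vec.Relation.Unary.All using ([]; _∷_)
open import Data.Vec.Relation.Unary.AllPairs using ([]; _∷_)
import Data.Vec.Relation.Unary.Unique.Propositional as Vec
import Data.Vec.Relation.Unary.Unique.Propositional.Properties as Vec
open import Function using (_∘_; id; _on_; case_of_)
open import Relation.Nullary using (¬_; yes; no; contradiction; ¬?)
open import Relation.Unary using (Decidable)
open import Relation.Binary.PropositionalEquality using (_≡_; _≢_; refl; sym; trans; cong; cong₂; subst; module ≡-Reasoning)

private
  variable
    A V W : Set
    m n : ℕ

-- Sublists

-- The edge lists of the doubled graphs are concatenations; this cuts the sorted edges of a walk
-- into the parts lying in each block.
++-split : ∀ (as : List A) {bs xs} → xs ⊆ as ++ bs →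
           ∃₂ λ ys zs → xs ≡ ys ++ zs × ys ⊆ as × zs ⊆ bs
++-split []       p           = [] , _ , refl , [] , p
++-split (a ∷ as) (.a ∷ʳ p)   with ++-split as p
... | ys , zs , eq , q , r    = ys , zs , eq , a ∷ʳ q , r
++-split (a ∷ as) (refl ∷ p)  with ++-split as p
... | ys , zs , refl , q , r  = a ∷ ys , zs , refl , refl ∷ q , r

2nd∈ : ∀ {x y : A} {xs ys} → x ∷ y ∷ xs ⊆ ys → y ∈ ys
2nd∈ p = Sublist.lookup p (there (here refl))

3rd∈ : ∀ {x y z : A} {xs ys} → x ∷ y ∷ z ∷ xs ⊆ ys → z ∈ ys
3rd∈ p = Sublist.lookup p (there (there (here refl)))

4th∈ : ∀ {x y z w : A} {xs ys} → x ∷ y ∷ z ∷ w ∷ xs ⊆ ys → w ∈ ys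
4th∈ p = Sublist.lookup p (there (there (there (here refl))))

AllPairs-resp-⊆ : ∀ {R : A → A → Set} {xs ys} → xs ⊆ ys → AllPairs R ys → AllPairs R xs
AllPairs-resp-⊆ []         []       = []
AllPairs-resp-⊆ (_ ∷ʳ p)   (_ ∷ rs) = AllPairs-resp-⊆ p rs
AllPairs-resp-⊆ (refl ∷ p) (r ∷ rs) = Sublist.All-resp-⊆ p r ∷ AllPairs-resp-⊆ p rs

lookup∷-⊆-drop : ∀ (xs : List A) i {ys} → ys ⊆ drop (suc (toℕ i)) xs →
                 lookup xs i ∷ ys ⊆ drop (toℕ i) xs
lookup∷-⊆-drop (x ∷ xs) zero    p = refl ∷ p
lookup∷-⊆-drop (x ∷ xs) (suc i) p = lookup∷-⊆-drop xs i p

map-lookup-⊆ : ∀ (xs : List A) {is} → Linked F._<_ is → map (lookup xs) is ⊆ xs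
map-lookup-⊆ xs {[]}     _  = minimum xs
map-lookup-⊆ xs {i ∷ is} ls = ⊆-trans (from i is ls) (Sublist.drop-⊆ (toℕ i) xs)
  where
  -- The induction needs a sharper claim: a list of indices starting at `i` already embeds in the
  -- suffix from position `i`.
  from : ∀ i is → Linked F._<_ (i ∷ is) → map (lookup xs) (i ∷ is) ⊆ drop (toℕ i) xs
  from i []       [-]      = lookup∷-⊆-drop xs i (minimum _)
  from i (j ∷ is) (l ∷ ls) =
    lookup∷-⊆-drop xs i (⊆-trans (from j is ls) (Sublist.drop⁺-≥ l))

-- Turns a sublist of edges into positions in the edge order, the form in which `ContainsP5` asks
-- for them.
embed : ∀ {xs ys : List A} → xs ⊆ ys → Fin (length xs) → Fin (length ys)
embed (_ ∷ʳ p) i       = suc (embed p i)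
embed (_ ∷ p)  zero    = zero
embed (_ ∷ p)  (suc i) = suc (embed p i)

embed-mono-< : ∀ {xs ys : List A} (p : xs ⊆ ys) {i j} → i F.< j → embed p i F.< embed p j
embed-mono-< (_ ∷ʳ p) i<j                         = s<s (embed-mono-< p i<j)
embed-mono-< (_ ∷ p)  {zero}  {suc j} _           = z<s
embed-mono-< (_ ∷ p)  {suc i} {suc j} (s<s i<j)   = s<s (embed-mono-< p i<j)

lookup-embed : ∀ {xs ys : List A} (p : xs ⊆ ys) i → lookup ys (embed p i) ≡ lookup xs i
lookup-embed (_ ∷ʳ p)   i       = lookup-embed p i
lookup-embed (refl ∷ p) zero    = refl
lookup-embed (refl ∷ p) (suc i) = lookup-embed p i

-- Ordered walks

Joins : V × V → V → V → Set
Joins e x y = e ≡ (x , y) ⊎ e ≡ (y , x)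

joins-sym : ∀ {e : V × V} {x y} → Joins e x y → Joins e y x
joins-sym = Sum.swap

both : (V → W) → V × V → W × W
both f = Prod.map f f

joins-map : ∀ (f : V → W) {e x y} → Joins e x y → Joins (both f e) (f x) (f y)
joins-map f = Sum.map (cong (both f)) (cong (both f))

-- The list σ enumerates the edges of the walk in the order in which they occur in l.
WalkFree : List (Fin 4) → List (V × V) → Set
WalkFree {V} σ l = ∀ (v : Fin 5 → V) (e : Fin 4 → V × V) →
  (∀ i → Joins (e i) (v (inject₁ i)) (v (suc i))) → ¬ (map e σ ⊆ l)

-- The retraction `r` carries every walk over `W` to a walk over `V` and undoes `f` on the list, so
-- it makes no difference whether the walk's vertices lie in the image of `f`.
walkFree-map : ∀ {σ l} (f : V → W) (r : W → V) → (∀ x → r (f x) ≡ x) →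
               WalkFree σ l → WalkFree σ (map (both f) l)
walkFree-map {σ = σ} {l} f r r∘f free v e joins p =
  free (r ∘ v) (both r ∘ e) (λ i → joins-map r (joins i))
    (⊆-trans (⊆-reflexive (map-∘ σ)) (⊆-trans (Sublist.map⁺ (both r) p) (⊆-reflexive retract)))
  where
  retract : map (both r) (map (both f) l) ≡ l
  retract = trans (sym (map-∘ l))
    (trans (map-cong (λ (x , y) → cong₂ _,_ (r∘f x) (r∘f y)) l) (map-id l))

-- `WalkFree` also excludes walks with repeated vertices, so it is stronger than avoiding the path.
-- Labels increase along `σ`, hence so do the positions, and the edges in that order form a sublist.
walkFree⇒¬contains : ∀ {σ} {a : Fin 4 → ℕ} → Linked (_<_ on a) σ →
                     (G : EOGraph n) → WalkFree σ (edges G) → ¬ ContainsP5 G a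
walkFree⇒¬contains {σ = σ} sorted G free (f , _ , pos , at , mono) =
  free f (lookup (edges G) ∘ pos) at
    (⊆-trans (⊆-reflexive (map-∘ σ))
      (map-lookup-⊆ (edges G) (Linked.map⁺ (Linked.map (mono _ _) sorted))))

-- Doubling

both-injective : ∀ {f : V → W} → (∀ {x y} → f x ≡ f y → x ≡ y) →
                 ∀ {d e} → both f d ≡ both f e → d ≡ e
both-injective inj eq = cong₂ _,_ (inj (Prod.,-injectiveˡ eq)) (inj (Prod.,-injectiveʳ eq))

module Doubling (G : EOGraph m) where

  Edge₂ : Set
  Edge₂ = Fin (2 * m) × Fin (2 * m)

  -- `combine` is lexicographic: side `0F` comes wholly before side `1F`, so a rung written from
  -- side `0F` has its smaller end first.
  vertex : Fin 2 → Fin m → Fin (2 * m)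
  vertex = combine

  vertex-injective : ∀ b i j → vertex b i ≡ vertex b j → i ≡ j
  vertex-injective b i j = F.combine-injectiveʳ b i b j

  side : Fin (2 * m) → Fin 2
  side = proj₁ ∘ remQuot {2} m

  base : Fin (2 * m) → Fin m
  base = proj₂ ∘ remQuot {2} m

  side-vertex : ∀ b i → side (vertex b i) ≡ b
  side-vertex b i = cong proj₁ (F.remQuot-combine {2} {m} b i)

  base-vertex : ∀ b i → base (vertex b i) ≡ i
  base-vertex b i = cong proj₂ (F.remQuot-combine {2} {m} b i)

  rung : Fin m → Edge₂
  rung i = vertex 0F i , vertex 1F i

  copy : Fin 2 → List Edge₂
  copy b = map (both (vertex b)) (edges G)

  rungs : List Edge₂
  rungs = map rung (allFin m)

  Increasing : Edge₂ → Set
  Increasing e = proj₁ e F.< proj₂ e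

  vertex-monoʳ-< : ∀ (b : Fin 2) {i j : Fin m} → i F.< j → vertex b i F.< vertex b j
  vertex-monoʳ-< b {i} {j} i<j
    rewrite F.toℕ-combine b i | F.toℕ-combine b j = +-monoʳ-< (m * toℕ b) i<j

  copy-increasing : ∀ b → All Increasing (copy b)
  copy-increasing b = All.map⁺ (All.map (vertex-monoʳ-< b) (simple G))

  rungs-increasing : All Increasing rungs
  rungs-increasing = All.map⁺ (All.universal (λ i → F.combine-monoˡ-< {2} {m} {0F} {1F} i i (s≤s z≤n)) (allFin m))

  copy-unique : ∀ b → Unique (copy b)
  copy-unique b = Unique.map⁺ (both-injective λ {x} {y} → vertex-injective b x y) (unique G)

  rungs-unique : Unique rungs
  rungs-unique = Unique.map⁺ (λ {i} {j} eq → vertex-injective 0F i j (cong proj₁ eq))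
                             (Unique.allFin⁺ m)

  copy-side : ∀ b {e x y} → e ∈ copy b → Joins e x y → side x ≡ b
  copy-side b e∈ j with ∈-map⁻ (both (vertex b)) e∈
  copy-side b e∈ (inj₁ refl) | (x , y) , _ , refl = side-vertex b x
  copy-side b e∈ (inj₂ refl) | (x , y) , _ , refl = side-vertex b y

  -- The rungs form a perfect matching: either end, through its `base`, determines the rung.
  rung-at : ∀ {e x y} → e ∈ rungs → Joins e x y → e ≡ rung (base x)
  rung-at e∈ j with ∈-map⁻ rung e∈
  rung-at e∈ (inj₁ refl) | i , _ , refl = cong rung (sym (base-vertex 0F i))
  rung-at e∈ (inj₂ refl) | i , _ , refl = cong rung (sym (base-vertex 1F i))

  rung-crosses : ∀ {e x y} → e ∈ rungs → Joins e x y → side x ≢ side y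
  rung-crosses e∈ j eq with ∈-map⁻ rung e∈
  rung-crosses e∈ (inj₁ refl) eq | i , _ , refl
    with () ← trans (sym (side-vertex 0F i)) (trans eq (side-vertex 1F i))
  rung-crosses e∈ (inj₂ refl) eq | i , _ , refl
    with () ← trans (sym (side-vertex 1F i)) (trans eq (side-vertex 0F i))

  copies-apart : ∀ {d e x y z} → d ∈ copy 0F → e ∈ copy 1F → Joins d x y → Joins e x z → ⊥
  copies-apart d∈ e∈ p q with () ← trans (sym (copy-side 0F d∈ p)) (copy-side 1F e∈ q)

  -- A shared end would make the two rungs equal, but successive entries of a sublist of a
  -- repetition-free list differ.
  rungs-apart : ∀ {d e ds x y z} → d ∷ e ∷ ds ⊆ rungs → Joins d x y → Joins e x z → ⊥
  rungs-apart s p q with AllPairs-resp-⊆ s rungs-unique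
  ... | (d≢e ∷ _) ∷ _ = d≢e (trans (rung-at (to∈ s) p)
                          (sym (rung-at (2nd∈ s) q)))

  -- The rung changes side between `x` and `y`, while its two neighbours in the walk put both on
  -- side `b`.
  rung-separates : ∀ b {c d e w x y z} → c ∈ copy b → d ∈ rungs → e ∈ copy b →
                   Joins c w x → Joins d x y → Joins e y z → ⊥
  rung-separates b c∈ d∈ e∈ p q r =
    rung-crosses d∈ q (trans (copy-side b c∈ (joins-sym p)) (sym (copy-side b e∈ r)))

  copies-disjoint : Disjoint (copy 0F) (copy 1F)
  copies-disjoint (p , q) = copies-apart p q (inj₁ refl) (inj₁ refl)

  copy-rungs-disjoint : ∀ b → Disjoint (copy b) rungs
  copy-rungs-disjoint b (p , q) =
    rung-separates b p q p (inj₁ refl) (inj₂ refl) (inj₁ refl)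

  copy-walkFree : ∀ b {σ} → WalkFree σ (edges G) → WalkFree σ (copy b)
  copy-walkFree b = walkFree-map (vertex b) base (base-vertex b)

  length-copy : ∀ b → length (copy b) ≡ ∣E∣ G
  length-copy b = length-map _ (edges G)

  length-rungs : length rungs ≡ m
  length-rungs = trans (length-map rung (allFin m)) (length-tabulate id)

double-rungsLast : EOGraph m → EOGraph (2 * m)
double-rungsLast G = record
  { edges  = copy 0F ++ copy 1F ++ rungs
  ; simple = All.++⁺ (copy-increasing 0F) (All.++⁺ (copy-increasing 1F) rungs-increasing)
  ; unique = Unique.++⁺ (copy-unique 0F)
      (Unique.++⁺ (copy-unique 1F) rungs-unique (copy-rungs-disjoint 1F))
      λ (p , q) → [ (λ r → copies-disjoint (p , r)) , (λ r → copy-rungs-disjoint 0F (p , r)) ]′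
                    (∈-++⁻ (copy 1F) q)
  }
  where open Doubling G

double-rungsMiddle : EOGraph m → EOGraph (2 * m)
double-rungsMiddle G = record
  { edges  = copy 0F ++ rungs ++ copy 1F
  ; simple = All.++⁺ (copy-increasing 0F) (All.++⁺ rungs-increasing (copy-increasing 1F))
  ; unique = Unique.++⁺ (copy-unique 0F)
      (Unique.++⁺ rungs-unique (copy-unique 1F) (λ (p , q) → copy-rungs-disjoint 1F (q , p)))
      λ (p , q) → [ (λ r → copy-rungs-disjoint 0F (p , r)) , (λ r → copies-disjoint (p , r)) ]′
                    (∈-++⁻ rungs q)
  }
  where open Doubling G

∣double-rungsLast∣ : ∀ (G : EOGraph m) → ∣E∣ (double-rungsLast G) ≡ 2 * ∣E∣ G + m
∣double-rungsLast∣ {m} G = trans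
  (trans (length-++ (copy 0F)) (cong₂ _+_ (length-copy 0F)
    (trans (length-++ (copy 1F)) (cong₂ _+_ (length-copy 1F) length-rungs))))
  (shape (∣E∣ G) m)
  where
  open Doubling G
  shape : ∀ g m → g + (g + m) ≡ 2 * g + m
  shape = solve-∀

∣double-rungsMiddle∣ : ∀ (G : EOGraph m) → ∣E∣ (double-rungsMiddle G) ≡ 2 * ∣E∣ G + m
∣double-rungsMiddle∣ {m} G = trans
  (trans (length-++ (copy 0F)) (cong₂ _+_ (length-copy 0F)
    (trans (length-++ rungs) (cong₂ _+_ length-rungs (length-copy 1F)))))
  (shape (∣E∣ G) m)
  where
  open Doubling G
  shape : ∀ g m → g + (m + g) ≡ 2 * g + m
  shape = solve-∀

-- The inverses of the label permutations, counted from 0: the path edges by increasing label.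
σ1342 σ2143 : List (Fin 4)
σ1342 = 0F ∷ 3F ∷ 1F ∷ 2F ∷ []
σ2143 = 1F ∷ 0F ∷ 3F ∷ 2F ∷ []

-- The two top edges `e 1F` and `e 2F` are adjacent, so they are not both rungs. If only `e 2F` is a
-- rung, either `e 1F` and `e 3F` lie in one copy, though the rung between them changes side, or the
-- adjacent edges `e 0F` and `e 1F` lie in different copies. Without rungs a walk stays in one copy.
double-1342-free : (G : EOGraph m) → WalkFree σ1342 (edges G) →
                   WalkFree σ1342 (edges (double-rungsLast G))
double-1342-free G free v e j p
  with ys , _ , eq , p₀ , p′ ← ++-split (Doubling.copy G 0F) p
  with zs , ms , refl , p₁ , p₂ ← ++-split (Doubling.copy G 1F) p′ = go ys zs ms eq p₀ p₁ p₂
  where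
  open Doubling G
  go : ∀ ys zs ms → map e σ1342 ≡ ys ++ zs ++ ms →
       ys ⊆ copy 0F → zs ⊆ copy 1F → ms ⊆ rungs → ⊥
  -- Fifteen clauses, one for each way to cut four sorted edges into three consecutive blocks.
  go (_ ∷ _ ∷ _ ∷ _ ∷ []) [] [] refl a b r = copy-walkFree 0F free v e j a
  go (_ ∷ _ ∷ _ ∷ []) [] (_ ∷ []) refl a b r =
    rung-separates 0F (3rd∈ a) (to∈ r) (2nd∈ a) (j 1F) (j 2F) (j 3F)
  go (_ ∷ _ ∷ _ ∷ []) (_ ∷ []) [] refl a b r = copies-apart (3rd∈ a) (to∈ b) (joins-sym (j 1F)) (j 2F)
  go (_ ∷ _ ∷ []) [] (_ ∷ _ ∷ []) refl a b r = rungs-apart r (joins-sym (j 1F)) (j 2F)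
  go (_ ∷ _ ∷ []) (_ ∷ []) (_ ∷ []) refl a b r = copies-apart (to∈ a) (to∈ b) (joins-sym (j 0F)) (j 1F)
  go (_ ∷ _ ∷ []) (_ ∷ _ ∷ []) [] refl a b r = copies-apart (to∈ a) (to∈ b) (joins-sym (j 0F)) (j 1F)
  go (_ ∷ []) [] (_ ∷ _ ∷ _ ∷ []) refl a b r = rungs-apart (Sublist.∷ˡ⁻ r) (joins-sym (j 1F)) (j 2F)
  go (_ ∷ []) (_ ∷ []) (_ ∷ _ ∷ []) refl a b r = rungs-apart r (joins-sym (j 1F)) (j 2F)
  go (_ ∷ []) (_ ∷ _ ∷ []) (_ ∷ []) refl a b r = copies-apart (to∈ a) (2nd∈ b) (joins-sym (j 0F)) (j 1F)
  go (_ ∷ []) (_ ∷ _ ∷ _ ∷ []) [] refl a b r = copies-apart (to∈ a) (2nd∈ b) (joins-sym (j 0F)) (j 1F)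
  go [] [] (_ ∷ _ ∷ _ ∷ _ ∷ []) refl a b r = rungs-apart (Sublist.∷ˡ⁻ (Sublist.∷ˡ⁻ r)) (joins-sym (j 1F)) (j 2F)
  go [] (_ ∷ []) (_ ∷ _ ∷ _ ∷ []) refl a b r = rungs-apart (Sublist.∷ˡ⁻ r) (joins-sym (j 1F)) (j 2F)
  go [] (_ ∷ _ ∷ []) (_ ∷ _ ∷ []) refl a b r = rungs-apart r (joins-sym (j 1F)) (j 2F)
  go [] (_ ∷ _ ∷ _ ∷ []) (_ ∷ []) refl a b r =
    rung-separates 1F (3rd∈ b) (to∈ r) (2nd∈ b) (j 1F) (j 2F) (j 3F)
  go [] (_ ∷ _ ∷ _ ∷ _ ∷ []) [] refl a b r = copy-walkFree 1F free v e j b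

-- The lowest edge `e 1F` and the highest edge `e 2F` are adjacent, so they cannot lie in different
-- copies. If `e 2F` is a rung, then `e 3F` is an adjacent rung or lies with `e 1F` in the first
-- copy, on both sides of that rung. The case of `e 1F` a rung is symmetric, with `e 0F` and the
-- second copy.
double-2143-free : (G : EOGraph m) → WalkFree σ2143 (edges G) →
                   WalkFree σ2143 (edges (double-rungsMiddle G))
double-2143-free G free v e j p
  with ys , _ , eq , p₀ , p′ ← ++-split (Doubling.copy G 0F) p
  with ms , zs , refl , p₁ , p₂ ← ++-split (Doubling.rungs G) p′ = go ys ms zs eq p₀ p₁ p₂
  where
  open Doubling G
  go : ∀ ys ms zs → map e σ2143 ≡ ys ++ ms ++ zs →
       ys ⊆ copy 0F → ms ⊆ rungs → zs ⊆ copy 1F → ⊥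
  go (_ ∷ _ ∷ _ ∷ _ ∷ []) [] [] refl a r b = copy-walkFree 0F free v e j a
  go (_ ∷ _ ∷ _ ∷ []) (_ ∷ []) [] refl a r b =
    rung-separates 0F (to∈ a) (to∈ r) (3rd∈ a) (j 1F) (j 2F) (j 3F)
  go (_ ∷ _ ∷ _ ∷ []) [] (_ ∷ []) refl a r b = copies-apart (to∈ a) (to∈ b) (joins-sym (j 1F)) (j 2F)
  go (_ ∷ _ ∷ []) (_ ∷ _ ∷ []) [] refl a r b = rungs-apart r (j 3F) (joins-sym (j 2F))
  go (_ ∷ _ ∷ []) (_ ∷ []) (_ ∷ []) refl a r b = copies-apart (to∈ a) (to∈ b) (joins-sym (j 1F)) (j 2F)
  go (_ ∷ _ ∷ []) [] (_ ∷ _ ∷ []) refl a r b = copies-apart (to∈ a) (2nd∈ b) (joins-sym (j 1F)) (j 2F)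
  go (_ ∷ []) (_ ∷ _ ∷ _ ∷ []) [] refl a r b = rungs-apart (Sublist.∷ˡ⁻ r) (j 3F) (joins-sym (j 2F))
  go (_ ∷ []) (_ ∷ _ ∷ []) (_ ∷ []) refl a r b = copies-apart (to∈ a) (to∈ b) (joins-sym (j 1F)) (j 2F)
  go (_ ∷ []) (_ ∷ []) (_ ∷ _ ∷ []) refl a r b = copies-apart (to∈ a) (2nd∈ b) (joins-sym (j 1F)) (j 2F)
  go (_ ∷ []) [] (_ ∷ _ ∷ _ ∷ []) refl a r b = copies-apart (to∈ a) (3rd∈ b) (joins-sym (j 1F)) (j 2F)
  go [] (_ ∷ _ ∷ _ ∷ _ ∷ []) [] refl a r b = rungs-apart r (j 1F) (joins-sym (j 0F))
  go [] (_ ∷ _ ∷ _ ∷ []) (_ ∷ []) refl a r b = rungs-apart r (j 1F) (joins-sym (j 0F))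
  go [] (_ ∷ _ ∷ []) (_ ∷ _ ∷ []) refl a r b = rungs-apart r (j 1F) (joins-sym (j 0F))
  go [] (_ ∷ []) (_ ∷ _ ∷ _ ∷ []) refl a r b =
    rung-separates 1F (to∈ b) (to∈ r) (3rd∈ b) (j 0F) (j 1F) (j 2F)
  go [] [] (_ ∷ _ ∷ _ ∷ _ ∷ []) refl a r b = copy-walkFree 1F free v e j b

-- Lower bounds

n<2^[1+⌊log₂n⌋] : ∀ n → n < 2 ^ suc ⌊log₂ n ⌋
n<2^[1+⌊log₂n⌋] n = ≰⇒> λ 2^≤n → 1+n≰n
  (≤-trans (≤-reflexive (sym (⌊log₂[2^n]⌋≡n (suc ⌊log₂ n ⌋)))) (⌊log₂⌋-mono-≤ 2^≤n))

-- Strong induction: for `n` at least 2, halving lowers the logarithm by exactly one.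
2^⌊log₂n⌋≤n : ∀ n → 1 ≤ n → 2 ^ ⌊log₂ n ⌋ ≤ n
2^⌊log₂n⌋≤n = <-rec _ λ where
  (suc zero)        _   _ → ≤-refl
  n@(suc (suc n-2)) rec _ →
    let h      = ⌊ n /2⌋
        log-h  = ⌊log₂⌊n/2⌋⌋≡⌊log₂n⌋∸1 n
        1≤log  = ⌊log₂⌋-mono-≤ {2} {n} (s≤s (s≤s z≤n))
        open ≤-Reasoning
    in begin
      2 ^ ⌊log₂ n ⌋            ≡⟨ cong (2 ^_) (sym (m+[n∸m]≡n 1≤log)) ⟩
      2 * 2 ^ (⌊log₂ n ⌋ ∸ 1) ≡⟨ cong (λ k → 2 * 2 ^ k) (sym log-h) ⟩
      2 * 2 ^ ⌊log₂ h ⌋        ≤⟨ *-monoʳ-≤ 2 (rec (⌊n/2⌋<n (suc n-2)) (s≤s z≤n)) ⟩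
      h + (h + 0)              ≡⟨ cong (h +_) (+-identityʳ h) ⟩
      h + h                    ≤⟨ +-monoʳ-≤ h (⌊n/2⌋≤⌈n/2⌉ n) ⟩
      h + ⌈ n /2⌉              ≡⟨ ⌊n/2⌋+⌈n/2⌉≡n n ⟩
      n                        ∎

pad : ∀ k → EOGraph n → EOGraph (n + k)
pad k G = record
  { edges  = map (both (_↑ˡ k)) (edges G)
  ; simple = All.map⁺ (All.map increasing (simple G))
  ; unique = Unique.map⁺ (both-injective λ {x} {y} → F.↑ˡ-injective k x y) (unique G)
  }
  where
  increasing : ∀ {e} → proj₁ e F.< proj₂ e → (proj₁ e ↑ˡ k) F.< (proj₂ e ↑ˡ k)
  increasing {x , y} x<y rewrite F.toℕ-↑ˡ x k | F.toℕ-↑ˡ y k = x<y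

-- The argument of type `Fin n` is the value of the retraction on the added isolated vertices; any
-- vertex will do.
pad-walkFree : ∀ k (G : EOGraph n) {σ} → Fin n → WalkFree σ (edges G) → WalkFree σ (edges (pad k G))
pad-walkFree {n} k G x = walkFree-map (_↑ˡ k) ([ id , (λ _ → x) ]′ ∘ splitAt n)
  (λ y → cong [ id , (λ _ → x) ]′ (F.splitAt-↑ˡ n y k))

-- From one vertex, k doublings give k 2^(k-1) edges on 2^k vertices; both doublings used build the
-- hypercube. Take k = `⌊log₂ n ⌋` and pad up to `n`. The constant 4 is one factor 2 from n < 2 *
-- 2^k and one from the edge count.
doubling⇒Ω[nlogn] :
  ∀ {a σ} → Linked (_<_ on a) σ → 1 ≤ length σ →
  (D : ∀ {m} → EOGraph m → EOGraph (2 * m)) →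
  (∀ {m} (G : EOGraph m) → ∣E∣ (D G) ≡ 2 * ∣E∣ G + m) →
  (∀ {m} (G : EOGraph m) → WalkFree σ (edges G) → WalkFree σ (edges (D G))) →
  ∀ n → 1 ≤ n → Σ (EOGraph n) λ G → (¬ ContainsP5 G a) × (n * ⌊log₂ n ⌋ ≤ 4 * ∣E∣ G)
doubling⇒Ω[nlogn] {a} {σ} sorted 1≤∣σ∣ D ∣D∣ D-free n 1≤n =
  padded (m≤n⇒∃[o]m+o≡n (2^⌊log₂n⌋≤n n 1≤n)) (n<2^[1+⌊log₂n⌋] n)
  where
  cube : ∀ k → EOGraph (2 ^ k)
  cube zero    = record { edges = [] ; simple = [] ; unique = [] }
  cube (suc k) = D (cube k)

  cube-free : ∀ k → WalkFree σ (edges (cube k))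
  -- A single vertex has no edges, whereas a nonempty `σ` asks for at least one.
  cube-free zero    v e joins p =
    n≮0 (≤-trans (≤-trans 1≤∣σ∣ (≤-reflexive (sym (length-map e σ)))) (Sublist.length-mono-≤ p))
  cube-free (suc k) = D-free (cube k) (cube-free k)

  origin : ∀ k → Fin (2 ^ k)
  origin zero    = zero
  origin (suc k) = combine {2} 0F (origin k)

  -- Stated for twice the edge count, to keep the exponent k-1 out.
  ∣cube∣ : ∀ k → 2 * ∣E∣ (cube k) ≡ k * 2 ^ k
  ∣cube∣ zero    = refl
  ∣cube∣ (suc k) = begin
    2 * ∣E∣ (D (cube k))               ≡⟨ cong (2 *_) (∣D∣ (cube k)) ⟩
    2 * (2 * ∣E∣ (cube k) + 2 ^ k)     ≡⟨ cong (λ c → 2 * (c + 2 ^ k)) (∣cube∣ k) ⟩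
    2 * (k * 2 ^ k + 2 ^ k)            ≡⟨ shape k (2 ^ k) ⟩
    suc k * (2 * 2 ^ k)                ∎
    where
    open ≡-Reasoning
    shape : ∀ k p → 2 * (k * p + p) ≡ suc k * (2 * p)
    shape = solve-∀

  padded : ∀ {n k} → (∃ λ o → 2 ^ k + o ≡ n) → n < 2 ^ suc k →
           Σ (EOGraph n) λ G → (¬ ContainsP5 G a) × (n * k ≤ 4 * ∣E∣ G)
  padded {n} {k} (o , refl) n<2^ =
    pad o (cube k) ,
    walkFree⇒¬contains sorted (pad o (cube k)) (pad-walkFree o (cube k) (origin k) (cube-free k)) ,
    (begin
      n * k                          ≤⟨ *-monoˡ-≤ k (<⇒≤ n<2^) ⟩
      (2 * 2 ^ k) * k                ≡⟨ shape (2 ^ k) k ⟩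
      2 * (k * 2 ^ k)                ≡⟨ cong (2 *_) (∣cube∣ k) ⟨
      2 * (2 * ∣E∣ (cube k))         ≡⟨ *-assoc 2 2 (∣E∣ (cube k)) ⟨
      4 * ∣E∣ (cube k)               ≡⟨ cong (4 *_) (length-map _ (edges (cube k))) ⟨
      4 * ∣E∣ (pad o (cube k))       ∎)
    where
    open ≤-Reasoning
    shape : ∀ p k → (2 * p) * k ≡ 2 * (k * p)
    shape = solve-∀

1342-sorted : Linked (_<_ on P5-1342) σ1342
1342-sorted = ≤-refl ∷ ≤-refl ∷ ≤-refl ∷ [-]

2143-sorted : Linked (_<_ on P5-2143) σ2143
2143-sorted = ≤-refl ∷ ≤-refl ∷ ≤-refl ∷ [-]

-- Upper bound

Incident : V → V × V → Set
Incident x e = ∃ λ y → Joins e x y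

incident? : ∀ (x : Fin n) → Decidable (Incident x)
incident? x (u , v) with u F.≟ x | v F.≟ x
... | yes refl | _        = yes (v , inj₁ refl)
... | no _     | yes refl = yes (u , inj₂ refl)
... | no u≢x   | no v≢x   = no λ { (_ , inj₁ refl) → u≢x refl ; (_ , inj₂ refl) → v≢x refl }

-- Trimming and halving lists

Shielded : (A → Set) → ℕ → List A → A → Set
Shielded P r xs e = ∃ λ fs → length fs ≡ r × All P fs × fs ++ [ e ] ⊆ xs

shielded-resp-⊆ : ∀ {P : A → Set} {r xs ys e} → xs ⊆ ys → Shielded P r xs e → Shielded P r ys e
shielded-resp-⊆ p (fs , len , all , q) = fs , len , all , ⊆-trans q p

-- Deletes the first `r` entries satisfying `P`, or all of them if there are fewer. A surviving
-- entry with `P` therefore has `r` deleted ones before it, and these are its shield.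
trim : ∀ {P : A → Set} → Decidable P → ∀ r xs →
       ∃ λ ys → ys ⊆ xs × length xs ≤ r + length ys × (∀ {e} → e ∈ ys → P e → Shielded P r xs e)
trim P? zero    xs       = xs , ⊆-refl , ≤-refl , λ e∈ _ → [] , refl , [] , from∈ e∈
trim P? (suc r) []       = [] , [] , z≤n , λ ()
trim P? (suc r) (x ∷ xs) with P? x
... | yes px = let ys , sub , len , shield = trim P? r xs in
  ys , x ∷ʳ sub , s≤s len , λ e∈ pe →
    let fs , ∣fs∣ , pfs , fs⊆ = shield e∈ pe in x ∷ fs , cong suc ∣fs∣ , px ∷ pfs , refl ∷ fs⊆
... | no ¬px = let ys , sub , len , shield = trim P? (suc r) xs in
  x ∷ ys , refl ∷ sub , ≤-trans (s≤s len) (≤-reflexive (sym (+-suc (suc r) (length ys)))) , λ where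
    (here refl) px → contradiction px ¬px
    (there e∈)  pe → shielded-resp-⊆ (x ∷ʳ ⊆-refl) (shield e∈ pe)

-- Trims for one index after another, at a cost of at most `r` entries each. A shield found in an
-- intermediate list is still one in `xs`, since that list is a sublist.
trimAll : ∀ {I : Set} {P : I → A → Set} → (∀ i → Decidable (P i)) → ∀ r (is : List I) xs →
          ∃ λ ys → ys ⊆ xs × length xs ≤ r * length is + length ys ×
            (∀ {i e} → i ∈ is → e ∈ ys → P i e → Shielded (P i) r xs e)
trimAll P? r []       xs = xs , ⊆-refl , m≤n+m _ (r * 0) , λ ()
trimAll P? r (i ∷ is) xs =
  let ys , ys⊆ , lenʸ , shieldʸ = trim (P? i) r xs
      zs , zs⊆ , lenᶻ , shieldᶻ = trimAll P? r is ys
      open ≤-Reasoning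
  in zs , ⊆-trans zs⊆ ys⊆ ,
     (begin
       length xs                             ≤⟨ lenʸ ⟩
       r + length ys                         ≤⟨ +-monoʳ-≤ r lenᶻ ⟩
       r + (r * length is + length zs)       ≡⟨ +-assoc r _ _ ⟨
       (r + r * length is) + length zs       ≡⟨ cong (_+ length zs) (*-suc r (length is)) ⟨
       r * suc (length is) + length zs       ∎) ,
     λ where
       (here refl) e∈ pe → shieldʸ (Sublist.lookup zs⊆ e∈) pe
       (there j∈)  e∈ pe → shielded-resp-⊆ ys⊆ (shieldᶻ j∈ e∈ pe)

-- The `suc` pays for the odd entry when the shorter half is doubled.
halve : ∀ (xs : List A) → ∃₂ λ ys zs → xs ≡ ys ++ zs ×
        length xs ≤ suc (2 * length ys) × length xs ≤ suc (2 * length zs)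
halve xs =
  take h xs , drop h xs , sym (take++drop≡id h xs) ,
  subst (λ y → N ≤ suc (2 * y)) (sym ∣take∣) (begin
    N                      ≡⟨ ⌊n/2⌋+⌈n/2⌉≡n N ⟨
    h + ⌈ N /2⌉            ≤⟨ +-monoʳ-≤ h (⌊n/2⌋-mono (n≤1+n (suc N))) ⟩
    h + suc h              ≡⟨ +-suc h h ⟩
    suc (h + h)            ≡⟨ cong (λ z → suc (h + z)) (+-identityʳ h) ⟨
    suc (2 * h)            ∎) ,
  subst (λ z → N ≤ suc (2 * z)) (sym ∣drop∣) (begin
    N                      ≡⟨ ⌊n/2⌋+⌈n/2⌉≡n N ⟨
    h + ⌈ N /2⌉            ≤⟨ +-mono-≤ (⌊n/2⌋≤⌈n/2⌉ N) (m≤m+n _ 0) ⟩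
    2 * ⌈ N /2⌉            ≤⟨ n≤1+n _ ⟩
    suc (2 * ⌈ N /2⌉)      ∎)
  where
  open ≤-Reasoning
  N = length xs
  h = ⌊ N /2⌋
  ∣take∣ : length (take h xs) ≡ h
  ∣take∣ = trans (length-take h xs) (m≤n⇒m⊓n≡m (⌊n/2⌋≤n N))
  ∣drop∣ : length (drop h xs) ≡ ⌈ N /2⌉
  ∣drop∣ = trans (length-drop h xs)
    (trans (cong (_∸ h) (sym (⌊n/2⌋+⌈n/2⌉≡n N))) (m+n∸m≡n h ⌈ N /2⌉))

length-filter-∁ : ∀ {P : A → Set} (P? : Decidable P) xs →
                  length (filter P? xs) + length (filter (¬? ∘ P?) xs) ≡ length xs
length-filter-∁ P? []       = refl
length-filter-∁ P? (x ∷ xs) with P? x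
... | yes _ = cong suc (length-filter-∁ P? xs)
... | no  _ = trans (+-suc _ _) (cong suc (length-filter-∁ P? xs))

2*m≤m+n : ∀ {m n s} → m ≤ n → m + n ≡ s → 2 * m ≤ s
2*m≤m+n {m} m≤n refl = +-monoʳ-≤ m (≤-trans (≤-reflexive (+-identityʳ m)) m≤n)

pick : ∀ {P : Fin n → Set} {x y z} → x ≢ y → x ≢ z → y ≢ z → P x → P y → P z →
       ∀ p q → ∃ λ w → P w × w ≢ p × w ≢ q
pick {x = x} {y} {z} x≢y x≢z y≢z Px Py Pz p q with x F.≟ p | x F.≟ q
... | no x≢p   | no x≢q = x , Px , x≢p , x≢q
... | yes refl | _ with y F.≟ q
...   | no y≢q   = y , Py , x≢y ∘ sym , y≢q
...   | yes refl = z , Pz , x≢z ∘ sym , y≢z ∘ sym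
pick {x = x} {y} {z} x≢y x≢z y≢z Px Py Pz p q | no _ | yes refl with y F.≟ p
...   | no y≢p   = y , Py , y≢p , x≢y ∘ sym
...   | yes refl = z , Pz , y≢z ∘ sym , x≢z ∘ sym

-- From four sorted edges to a copy of the path

rank2143 : Fin 4 → Fin 4
rank2143 = Vec.lookup (1F ∷ 0F ∷ 3F ∷ 2F ∷ [])

P5-2143≡1+rank : ∀ i → P5-2143 i ≡ suc (toℕ (rank2143 i))
P5-2143≡1+rank 0F = refl
P5-2143≡1+rank 1F = refl
P5-2143≡1+rank 2F = refl
P5-2143≡1+rank 3F = refl

-- The labels 1, 2, 3, 4 sit on `e₂`, `e₁`, `e₄`, `e₃`, the order of the sublist. `rank2143` gives
-- each path edge its index there; 2143 is its own inverse.
contains-2143 : ∀ (G : EOGraph n) {v₁ v₂ v₃ v₄ v₅ e₁ e₂ e₃ e₄} →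
  Vec.Unique (v₁ ∷ v₂ ∷ v₃ ∷ v₄ ∷ v₅ ∷ []) →
  Joins e₁ v₁ v₂ → Joins e₂ v₂ v₃ → Joins e₃ v₃ v₄ → Joins e₄ v₄ v₅ →
  e₂ ∷ e₁ ∷ e₄ ∷ e₃ ∷ [] ⊆ edges G → ContainsP5 G P5-2143
contains-2143 G {v₁} {v₂} {v₃} {v₄} {v₅} {e₁} {e₂} {e₃} {e₄} distinct j₁ j₂ j₃ j₄ sub =
  Vec.lookup (v₁ ∷ v₂ ∷ v₃ ∷ v₄ ∷ v₅ ∷ []) ,
  Vec.lookup-injective distinct _ _ ,
  embed sub ∘ rank2143 ,
  (λ where
    0F → at 1F j₁
    1F → at 0F j₂
    2F → at 3F j₃
    3F → at 2F j₄) ,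
  λ i j i<j → embed-mono-< sub {rank2143 i} {rank2143 j}
    (s<s⁻¹ (≤-trans (s≤s (≤-reflexive (sym (P5-2143≡1+rank i))))
      (≤-trans i<j (≤-reflexive (P5-2143≡1+rank j)))))
  where
  at : ∀ i {x y} → Joins (lookup (e₂ ∷ e₁ ∷ e₄ ∷ e₃ ∷ []) i) x y → EdgeAt G (embed sub i) x y
  at i = Sum.map (trans (lookup-embed sub i)) (trans (lookup-embed sub i))

module Avoiding2143 (G : EOGraph n) (free : ¬ ContainsP5 G P5-2143) where

  joins⇒≢ : ∀ {e x y} → e ∈ edges G → Joins e x y → x ≢ y
  joins⇒≢ e∈ (inj₁ refl) = F.<⇒≢ (All.lookup (simple G) e∈)
  joins⇒≢ e∈ (inj₂ refl) = F.<⇒≢ (All.lookup (simple G) e∈) ∘ sym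

  -- Stored pairs have their smaller end first, so opposite orientations cannot both occur.
  joins-unique : ∀ {d e x y} → d ∈ edges G → e ∈ edges G → Joins d x y → Joins e x y → d ≡ e
  joins-unique d∈ e∈ (inj₁ refl) (inj₁ refl) = refl
  joins-unique d∈ e∈ (inj₂ refl) (inj₂ refl) = refl
  joins-unique d∈ e∈ (inj₁ refl) (inj₂ refl) =
    contradiction (All.lookup (simple G) e∈) (F.<-asym (All.lookup (simple G) d∈))
  joins-unique d∈ e∈ (inj₂ refl) (inj₁ refl) =
    contradiction (All.lookup (simple G) e∈) (F.<-asym (All.lookup (simple G) d∈))

  ends-differ : ∀ {d e x y z} → d ∈ edges G → e ∈ edges G → d ≢ e → Joins d x y → Joins e x z → y ≢ z
  ends-differ d∈ e∈ d≢e p q refl = d≢e (joins-unique d∈ e∈ p q)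

  Before After : Fin n × Fin n → Fin n → List (Fin n × Fin n) → Fin n → Set
  Before e x l y = ∃ λ f → Joins f x y × f ∷ e ∷ [] ⊆ l
  After  e x l y = ∃ λ f → Joins f x y × e ∷ f ∷ [] ⊆ l

  -- Three distinct edges at `x` have three distinct other ends, one of which avoids both `p` and
  -- `q`.
  before : ∀ {l e x} → l ⊆ edges G → Shielded (Incident x) 3 l e → ∀ p q →
           ∃ λ y → Before e x l y × y ≢ p × y ≢ q
  before l⊆ (f ∷ g ∷ h ∷ [] , refl , (_ , jf) ∷ (_ , jg) ∷ (_ , jh) ∷ [] , sub) =
    let sub′ = ⊆-trans sub l⊆
        f∈ = to∈ sub′
        g∈ = 2nd∈ sub′
        h∈ = 3rd∈ sub′
    in case AllPairs-resp-⊆ sub′ (unique G) of λ where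
      ((f≢g ∷ f≢h ∷ _) ∷ (g≢h ∷ _) ∷ _) → pick
        (ends-differ f∈ g∈ f≢g jf jg) (ends-differ f∈ h∈ f≢h jf jh) (ends-differ g∈ h∈ g≢h jg jh)
        (f , jf , ⊆-trans (refl ∷ _ ∷ʳ _ ∷ʳ ⊆-refl) sub)
        (g , jg , ⊆-trans (_ ∷ʳ refl ∷ _ ∷ʳ ⊆-refl) sub)
        (h , jh , ⊆-trans (_ ∷ʳ _ ∷ʳ ⊆-refl) sub)

  -- A shield in the reversed list consists of edges that come later in `l`.
  after : ∀ {l e x} → l ⊆ edges G → Shielded (Incident x) 3 (reverse l) e → ∀ p q →
          ∃ λ y → After e x l y × y ≢ p × y ≢ q
  after {l} l⊆ (f ∷ g ∷ h ∷ [] , refl , (_ , jf) ∷ (_ , jg) ∷ (_ , jh) ∷ [] , rsub) =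
    let sub  = ⊆-trans (Sublist.reverse⁺ rsub) (⊆-reflexive (reverse-involutive l))
        sub′ = ⊆-trans sub l⊆
        f∈ = 4th∈ sub′
        g∈ = 3rd∈ sub′
        h∈ = 2nd∈ sub′
    in case AllPairs-resp-⊆ sub′ (unique G) of λ where
      (_ ∷ (h≢g ∷ h≢f ∷ _) ∷ (g≢f ∷ _) ∷ _) → pick
        (ends-differ h∈ g∈ h≢g jh jg) (ends-differ h∈ f∈ h≢f jh jf) (ends-differ g∈ f∈ g≢f jg jf)
        (h , jh , ⊆-trans (refl ∷ refl ∷ _ ∷ʳ _ ∷ʳ []) sub)
        (g , jg , ⊆-trans (refl ∷ _ ∷ʳ refl ∷ _ ∷ʳ []) sub)
        (f , jf , ⊆-trans (refl ∷ _ ∷ʳ _ ∷ʳ refl ∷ []) sub)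

  -- The path is a′, a, c, b, b′ along `f`, `d`, `e`, `g`. Here `d` precedes `f` in `L`, `g`
  -- precedes `e` in `U`, and `L` precedes `U`, so the ranks read 2, 1, 4, 3.
  no-common-vertex : ∀ {L U c a b d e} → L ++ U ⊆ edges G →
    Shielded (Incident a) 3 (reverse L) d → Shielded (Incident b) 3 U e →
    Joins d c a → Joins e c b → ⊥
  no-common-vertex {L} {U} {c} {a} {b} {d} {e} LU⊆ shieldL shieldU jd je
    -- Vertices at distance at most two along the path differ because the graph is simple. That
    -- leaves `b` for `a′` to avoid, hence the repeated argument, and then `a` and `a′` for `b′`.
    with a′ , (f , jf , df⊆) , a′≢b , _ ← after (⊆-trans (Sublist.++⁺ʳ U ⊆-refl) LU⊆) shieldL b b
    with b′ , (g , jg , ge⊆) , b′≢a , b′≢a′ ← before (⊆-trans (Sublist.++⁺ˡ L ⊆-refl) LU⊆) shieldU a a′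
    with sub ← ⊆-trans (Sublist.++⁺ df⊆ ge⊆) LU⊆
    with (d≢f ∷ _ ∷ d≢e ∷ []) ∷ _ ∷ (g≢e ∷ []) ∷ _ ← AllPairs-resp-⊆ sub (unique G)
    = free (contains-2143 G distinct (joins-sym jf) (joins-sym jd) je jg sub)
    where
    d∈ = to∈ sub
    f∈ = 2nd∈ sub
    g∈ = 3rd∈ sub
    e∈ = 4th∈ sub
    distinct : Vec.Unique (a′ ∷ a ∷ c ∷ b ∷ b′ ∷ [])
    distinct =
      (joins⇒≢ f∈ (joins-sym jf) ∷ ends-differ f∈ d∈ (d≢f ∘ sym) jf (joins-sym jd) ∷ a′≢b ∷ b′≢a′ ∘ sym ∷ []) ∷
      (joins⇒≢ d∈ (joins-sym jd) ∷ ends-differ d∈ e∈ d≢e jd je ∷ b′≢a ∘ sym ∷ []) ∷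
      (joins⇒≢ e∈ je ∷ ends-differ e∈ g∈ (g≢e ∘ sym) (joins-sym je) jg ∷ []) ∷
      (joins⇒≢ g∈ jg ∷ []) ∷ [] ∷ []

  -- The halving recursion

  Covers : List (Fin n) → List (Fin n × Fin n) → Set
  Covers S l = ∀ {e x y} → e ∈ l → Joins e x y → x ∈ S

  covers-∅ : ∀ {l} → Covers [] l → length l ≡ 0
  covers-∅ {[]}    _   = refl
  covers-∅ {e ∷ l} cov with () ← cov (here refl) (inj₁ refl)

  -- Induction on `k`, with the list `S` of allowed vertices in place of the whole vertex set, since
  -- it is `S` that shrinks by half. The constant 7 is 2 * 3 for the edges trimmed at each vertex,
  -- plus 1 for rounding in `halve`.
  bound : ∀ k {l S} → l ⊆ edges G → Covers S l → length S < 2 ^ suc k →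
          length l ≤ 7 * k * length S
  bound _ {S = []} l⊆ cov _ = ≤-trans (≤-reflexive (covers-∅ cov)) z≤n
  bound zero {[]}    {_ ∷ []} l⊆ cov _ = z≤n
  -- With one vertex allowed, an edge would be a loop.
  bound zero {e ∷ l} {_ ∷ []} l⊆ cov _
    with here refl ← cov {x = proj₁ e} (here refl) (inj₁ refl)
       | here eq   ← cov {x = proj₂ e} (here refl) (inj₂ refl)
    = contradiction (sym eq) (joins⇒≢ (to∈ l⊆) (inj₁ refl))
  bound zero {S = _ ∷ _ ∷ _} l⊆ cov (s≤s (s≤s ()))
  bound (suc k) {l} {S@(_ ∷ _)} l⊆ cov ∣S∣<
    with L , U , refl , ∣l∣≤∣L∣ , ∣l∣≤∣U∣ ← halve l
    -- Reversal makes the trimmed edges the last three of `L` at each vertex.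
    with L′ , L′⊆ , ∣L∣≤ , shieldL ← trimAll incident? 3 S (reverse L)
    with U′ , U′⊆ , ∣U∣≤ , shieldU ← trimAll incident? 3 S U
    = case ≤-total (length S₁) (length S₂) of λ where
        (inj₁ S₁≤S₂) →
          let 2S₁≤S = 2*m≤m+n S₁≤S₂ ∣S₁∣+∣S₂∣
          in step {s = length S₁} ∣l∣≤∣L∣ (≤-trans (≤-reflexive (sym (length-reverse L))) ∣L∣≤)
               (≤-trans (≤-reflexive (sym (length-reverse L′)))
                 (bound k (⊆-trans L″⊆ (⊆-trans (Sublist.++⁺ʳ U ⊆-refl) l⊆)) covL (small 2S₁≤S)))
               2S₁≤S
        (inj₂ S₂≤S₁) →
          let 2S₂≤S = 2*m≤m+n S₂≤S₁ (trans (+-comm (length S₂) (length S₁)) ∣S₁∣+∣S₂∣)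
          in step {s = length S₂} ∣l∣≤∣U∣ ∣U∣≤
               (bound k (⊆-trans U′⊆ (⊆-trans (Sublist.++⁺ˡ L ⊆-refl) l⊆)) covU (small 2S₂≤S))
               2S₂≤S
    where
    L″⊆ : reverse L′ ⊆ L
    L″⊆ = ⊆-trans (Sublist.reverse⁺ L′⊆) (⊆-reflexive (reverse-involutive L))

    touched? : Decidable (λ c → Any (Incident c) (reverse L′))
    touched? c = any? (incident? c) (reverse L′)

    -- The vertices met by the trimmed `L`, and then all others; the shorter list receives the
    -- recursive call.
    S₁ = filter touched? S
    S₂ = filter (¬? ∘ touched?) S

    ∣S₁∣+∣S₂∣ : length S₁ + length S₂ ≡ length S
    ∣S₁∣+∣S₂∣ = length-filter-∁ touched? S

    covL : Covers S₁ (reverse L′)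
    covL e∈ j = ∈-filter⁺ touched? (cov (∈-++⁺ˡ (Sublist.lookup L″⊆ e∈)) j) (lose e∈ (_ , j))

    -- An end of a `U′`-edge that is met by the trimmed `L` would be the vertex `c` excluded by
    -- `no-common-vertex`.
    covU : Covers S₂ U′
    covU e∈ j = ∈-filter⁺ (¬? ∘ touched?) (cov e∈l j) λ touched →
      let d , d∈ , a , jd = find touched
      in no-common-vertex l⊆
           (shieldL (cov (∈-++⁺ˡ (Sublist.lookup L″⊆ d∈)) (joins-sym jd)) (Any.reverse⁻ d∈) (_ , joins-sym jd))
           (shieldU (cov e∈l (joins-sym j)) e∈ (_ , joins-sym j)) jd j
      where e∈l = ∈-++⁺ʳ L (Sublist.lookup U′⊆ e∈)

    small : ∀ {s} → 2 * s ≤ length S → s < 2 ^ suc k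
    small 2s≤ = *-cancelˡ-< 2 _ _ (≤-<-trans 2s≤ ∣S∣<)

    step : ∀ {N t t′ s} → N ≤ suc (2 * t) → t ≤ 3 * length S + t′ → t′ ≤ 7 * k * s →
           2 * s ≤ length S → N ≤ 7 * suc k * length S
    step {N} {t} {t′} {s} N≤ t≤ t′≤ 2s≤ = begin
      N                                        ≤⟨ N≤ ⟩
      1 + 2 * t                                ≤⟨ s≤s (*-monoʳ-≤ 2 (≤-trans t≤ (+-monoʳ-≤ (3 * ∣S∣) t′≤))) ⟩
      1 + 2 * (3 * ∣S∣ + 7 * k * s)            ≡⟨ shape₁ ∣S∣ k s ⟩
      -- The rounding term 1 is absorbed by one copy of `∣S∣`, since `S` is nonempty in this clause.
      1 + (6 * ∣S∣ + 7 * k * (2 * s))          ≤⟨ +-mono-≤ {1} {∣S∣} (s≤s z≤n) (+-monoʳ-≤ (6 * ∣S∣) (*-monoʳ-≤ (7 * k) 2s≤)) ⟩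
      ∣S∣ + (6 * ∣S∣ + 7 * k * ∣S∣)            ≡⟨ shape₂ ∣S∣ k ⟩
      7 * suc k * ∣S∣                          ∎
      where
      open ≤-Reasoning
      ∣S∣ = length S
      shape₁ : ∀ S k s → 1 + 2 * (3 * S + 7 * k * s) ≡ 1 + (6 * S + 7 * k * (2 * s))
      shape₁ = solve-∀
      shape₂ : ∀ S k → S + (6 * S + 7 * k * S) ≡ 7 * suc k * S
      shape₂ = solve-∀

2143-free⇒O[nlogn] : (G : EOGraph n) → ¬ ContainsP5 G P5-2143 → ∣E∣ G ≤ 7 * (n * ⌊log₂ n ⌋)
2143-free⇒O[nlogn] {n} G free = begin
  ∣E∣ G                                    ≤⟨ Avoiding2143.bound G free ⌊log₂ n ⌋ ⊆-refl (λ _ _ → ∈-allFin _)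
                                                (≤-<-trans (≤-reflexive ∣V∣) (n<2^[1+⌊log₂n⌋] n)) ⟩
  7 * ⌊log₂ n ⌋ * length (allFin n)        ≡⟨ cong (7 * ⌊log₂ n ⌋ *_) ∣V∣ ⟩
  7 * ⌊log₂ n ⌋ * n                        ≡⟨ *-assoc 7 ⌊log₂ n ⌋ n ⟩
  7 * (⌊log₂ n ⌋ * n)                      ≡⟨ cong (7 *_) (*-comm ⌊log₂ n ⌋ n) ⟩
  7 * (n * ⌊log₂ n ⌋)                      ∎
  where
  open ≤-Reasoning
  ∣V∣ : length (allFin n) ≡ n
  ∣V∣ = length-tabulate id

theorem4p11 : (Σ ℕ λ C → Σ ℕ λ N → ∀ n → N ≤ n →
    Σ (EOGraph n) λ G → (¬ ContainsP5 G P5-1342) × (n * ⌊log₂ n ⌋ ≤ C * ∣E∣ G))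
    ×
    ((Σ ℕ λ C → Σ ℕ λ N → ∀ n → N ≤ n →
    Σ (EOGraph n) λ G → (¬ ContainsP5 G P5-2143) × (n * ⌊log₂ n ⌋ ≤ C * ∣E∣ G))
    ×
    (Σ ℕ λ C → Σ ℕ λ N → ∀ n → N ≤ n →
    (G : EOGraph n) → ¬ ContainsP5 G P5-2143 → ∣E∣ G ≤ C * (n * ⌊log₂ n ⌋)))
theorem4p11 =
  -- The threshold is 1 because a power of two must fit below `n`.
  (4 , 1 , doubling⇒Ω[nlogn] 1342-sorted (s≤s z≤n) double-rungsLast ∣double-rungsLast∣ double-1342-free) ,
  (4 , 1 , doubling⇒Ω[nlogn] 2143-sorted (s≤s z≤n) double-rungsMiddle ∣double-rungsMiddle∣ double-2143-free) ,
  (7 , 0 , λ _ _ → 2143-free⇒O[nlogn])
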